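{- Let $r$ be even and let $G=(V,E)$ be a nice graph with maximum degree $\Delta\ge 4$ that does not contain any degree-choosable components of radius at most $r$. Let $H$ be a graph obtained from $G$ by applying the marking process to $G$ with backoff distance $b=6$ and removing all marked nodes (for any outcome of the randomness of the process), and let $v\in V(H)$. If $\deg_G(u)=\Delta$ for each $u\in N_r(v)$, then the $r$-hop BFS tree around $v$ has at least $(\Delta-2)^{r/2}$ nodes on level $r$ that are reachable from $v$ through paths of length $r$ consisting of unmarked nodes, or this depth-$r$ BFS tree contains a $T$-node reachable from $v$ through a path of unmarked nodes.
   Context: Graphs are finite, simple and undirected. A nice graph is a connected graph that is neither a path, a cycle, nor a clique. A degree-choosable component (DCC) of $G$ is a node-induced subgraph of $G$ that is 2-connected and is neither a clique nor an odd cycle; its radius is the radius of the induced subgraph. $N_r(v)$ is the set of nodes at distance at most $r$ from $v$ in $G$. Marking process with selection probability $p$ and backoff distance $b$, on an initially uncolored graph $G$: each node selects itself independently with probability $p$. Then, if there is another selected node within distance $b$ of a selected node, that node unselects itself (so the nodes remaining selected have pairwise distance greater than $b$). Otherwise the selected node picks two non-adjacent neighbors and colors them with color one; these two neighbors are called marked. All other nodes are unmarked (uncolored). A $T$-node is a node with two neighbors in $G$ that have the same color (i.e. two marked neighbors); in particular each node that stays selected and marks two neighbors is a $T$-node. The $r$-hop (depth-$r$) BFS tree around $v$ is the breadth-first search tree from $v$ in $H$, the graph of unmarked nodes, truncated at distance $r$; level $t$ consists of nodes at distance $t$ from $v$ in $H$. -}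

module Defs where

open import Data.Nat using (ℕ; zero; suc; _≤_)
open import Data.Nat.Divisibility using (_∣_)
open import Data.Fin using (Fin; toℕ)
open import Data.Fin.Subset using (Subset; _∈_)
open import Data.List using (List; []; _∷_; length; filter; allFin)
open import Data.List.Relation.Unary.Unique.Propositional using (Unique)
open import Data.Maybe using (Maybe; just; nothing)
open import Data.Product using (Σ; ∃; ∃-syntax; _×_; _,_)
open import Data.Refinement using (Refinement-syntax; value)
open import Data.Sum using (_⊎_)
open import Data.Unit using (⊤)
open import Function.Bundles using (_↔_; _↣_; _⇔_; module Inverse; module Injection)
open import Relation.Binary using (Decidable; Irreflexive; Symmetric)
open import Relation.Binary.PropositionalEquality using (_≡_; _≢_; cong)
open import Relation.Nullary using (¬_)

Least : (ℕ → Set) → ℕ → Set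
Least P m = P m × (∀ k → P k → m ≤ k)

Greatest : (ℕ → Set) → ℕ → Set
Greatest P m = P m × (∀ k → P k → k ≤ m)

AtLeast : ℕ → {A : Set} → (A → Set) → Set
AtLeast k {A} P = Σ (Fin k ↣ A) λ f → ∀ i → P (Injection.to f i)

record Graph (V : Set) : Set₁ where
  field
    Adj     : V → V → Set
    adj?    : Decidable Adj
    irrefl  : Irreflexive _≡_ Adj
    symAdj  : Symmetric Adj

open Graph public

induced : {V : Set} → Graph V → (P : V → Set) → Graph [ x ∈ V ∣ P x ]
induced G P = record
  { Adj    = λ x y → Adj G (value x) (value y)
  ; adj?   = λ x y → adj? G (value x) (value y)
  ; irrefl = λ x≡y → irrefl G (cong value x≡y)
  ; symAdj = symAdj G
  }

_[_] : ∀ {n} → Graph (Fin n) → (S : Subset n) → Graph [ x ∈ Fin n ∣ x ∈ S ]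
G [ S ] = induced G (_∈ S)

module _ {V : Set} (G : Graph V) where

  data Walk : ℕ → V → V → Set where
    stop : ∀ {x} → Walk zero x x
    step : ∀ {k x y z} → Adj G x y → Walk k y z → Walk (suc k) x z

  vertices : ∀ {k x y} → Walk k x y → List V
  vertices {x = x} stop       = x ∷ []
  vertices {x = x} (step _ w) = x ∷ vertices w

  Path : ℕ → V → V → Set
  Path k x y = Σ (Walk k x y) λ w → Unique (vertices w)

  Distance : V → V → ℕ → Set
  Distance x y = Least (λ k → Walk k x y)

  Within : ℕ → V → V → Set
  Within r x y = ∃[ d ] Distance x y d × d ≤ r

  Connected : Set
  Connected = ∀ x y → ∃[ k ] Walk k x y

  Eccentricity : V → ℕ → Set
  Eccentricity c = Greatest (λ d → ∃[ x ] Distance c x d)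

  Radius : ℕ → Set
  Radius = Least (λ e → ∃[ c ] Eccentricity c e)

  IsClique : Set
  IsClique = ∀ x y → x ≢ y → Adj G x y

  IsomorphicTo : ∀ {k} → (Fin k → Fin k → Set) → Set
  IsomorphicTo {k} R =
    Σ (V ↔ Fin k) λ f → ∀ x y → Adj G x y ⇔ R (Inverse.to f x) (Inverse.to f y)

PathAdj : ∀ {k} → Fin k → Fin k → Set
PathAdj i j = toℕ j ≡ suc (toℕ i) ⊎ toℕ i ≡ suc (toℕ j)

CycleAdj : ∀ {k} → Fin k → Fin k → Set
CycleAdj {k} i j = PathAdj i j
                 ⊎ (toℕ i ≡ 0 × suc (toℕ j) ≡ k)
                 ⊎ (toℕ j ≡ 0 × suc (toℕ i) ≡ k)

module _ {V : Set} (G : Graph V) where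

  IsPath : Set
  IsPath = ∃[ k ] IsomorphicTo G (PathAdj {k})

  IsCycle : ℕ → Set
  IsCycle k = 3 ≤ k × IsomorphicTo G (CycleAdj {k})

  IsOddCycle : Set
  IsOddCycle = ∃[ k ] ¬ (2 ∣ k) × IsCycle k

  Nice : Set
  Nice = Connected G × ¬ IsPath × ¬ (∃[ k ] IsCycle k) × ¬ IsClique G

  TwoConnected : Set
  TwoConnected = AtLeast 3 {V} (λ _ → ⊤)
               × Connected G
               × (∀ x → Connected (induced G (_≢ x)))

module _ {n : ℕ} (G : Graph (Fin n)) where

  degree : Fin n → ℕ
  degree v = length (filter (adj? G v) (allFin n))

  MaxDegree : ℕ → Set
  MaxDegree = Greatest (λ d → ∃[ v ] degree v ≡ d)

  DCC : Subset n → Set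
  DCC S = TwoConnected (G [ S ]) × ¬ IsClique (G [ S ]) × ¬ IsOddCycle (G [ S ])

  NoDCCOfRadiusAtMost : ℕ → Set
  NoDCCOfRadiusAtMost r = ∀ S ρ → DCC S → Radius (G [ S ]) ρ → ¬ (ρ ≤ r)

-- A partial colouring; uncoloured nodes are sent to nothing.
Colouring : ℕ → Set
Colouring n = Fin n → Maybe ℕ

module _ {n : ℕ} (G : Graph (Fin n)) where

  NonAdjacentNeighbours : Fin n → Fin n → Fin n → Set
  NonAdjacentNeighbours s x y = Adj G s x × Adj G s y × x ≢ y × ¬ Adj G x y

  -- A node whose neighbourhood is a clique has no admissible pair and
  -- marks nothing.
  data Picks (s : Fin n) : Maybe (Fin n × Fin n) → Set where
    pair : ∀ {x y} → NonAdjacentNeighbours s x y → Picks s (just (x , y))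
    none : (∀ x y → ¬ NonAdjacentNeighbours s x y) → Picks s nothing

  -- One outcome of the marking process: the random data are the set of
  -- nodes that initially select themselves (any subset) and the pairs picked;
  -- χ is the resulting colouring.  pick s is unused unless s stays selected.
  record MarkingOutcome (b : ℕ) (χ : Colouring n) : Set where
    field
      initial : Subset n
      pick    : Fin n → Maybe (Fin n × Fin n)

    StaysSelected : Fin n → Set
    StaysSelected s = s ∈ initial × (∀ t → t ∈ initial → t ≢ s → ¬ Within G b s t)

    Marked : Fin n → Set
    Marked u = ∃[ s ] ∃[ x ] ∃[ y ]
      StaysSelected s × pick s ≡ just (x , y) × (u ≡ x ⊎ u ≡ y)

    field
      picks   : ∀ s → StaysSelected s → Picks s (pick s)
      colours : ∀ u → (Marked u × χ u ≡ just 1) ⊎ (¬ Marked u × χ u ≡ nothing)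

  TNode : Colouring n → Fin n → Set
  TNode χ u = ∃[ x ] ∃[ y ] ∃[ c ]
    x ≢ y × Adj G u x × Adj G u y × χ x ≡ just c × χ y ≡ just c

Unmarked : ∀ {n} → Colouring n → Set
Unmarked {n} χ = [ u ∈ Fin n ∣ χ u ≡ nothing ]

unmarkedGraph : ∀ {n} → Graph (Fin n) → (χ : Colouring n) → Graph (Unmarked χ)
unmarkedGraph G χ = induced G (λ u → χ u ≡ nothing)

module _ {V : Set} (H : Graph V) (v : V) where

  BFSLevel : ℕ → V → Set
  BFSLevel t u = Distance H v u t

  InBFSTree : ℕ → V → Set
  InBFSTree r u = ∃[ t ] t ≤ r × BFSLevel t u

-- A cycle of even length at most 2r that is not a clique spans a degree-choosable
-- component of radius at most r. Closing up two BFS paths into such cycles shows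
-- that, in H: every node has a unique parent; if a node has two neighbours on its
-- own level, these are adjacent and all three have the same parent; and a node with
-- a neighbour on its own level has no child adjacent to a node with another parent.
--
-- Assume there is no T-node, so every node of the tree has at most one marked
-- neighbour. Let x be a node with a child. If x has at least Δ−2 children, almost
-- all of them have a child. Otherwise x has a neighbour on its own level, so its
-- children form cliques; one of size q contributes q(Δ−1−q) ≥ Δ−2 grandchildren.
-- Two adjacent childless siblings y, z with parent c cannot exist: their marked
-- neighbours a, a′ either coincide, giving K_{Δ+1}, or, by the backoff distance, are
-- marked by one node s, giving the even cycle y c z a′ s a. Hence at most one child
-- of any node is childless, at least Δ−2 grandchildren of x again have a child, and
-- the number of such nodes grows by the factor Δ−2 every two levels.
module Submission where

open import Defs
import Data.Nat as ℕ
open import Data.Nat using (ℕ; zero; suc; _+_; _*_; _≤_; _<_; _∸_; _^_; _/_; z≤n; s≤s; s≤s⁻¹; _≤?_)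
open import Data.Nat.Properties hiding (_≟_)
open import Data.Nat.Divisibility using (_∣_; divides)
open import Data.Nat.DivMod using (m*n/n≡m)
open import Data.Nat.Induction using (<-rec)
open import Data.Fin using (Fin; inject≤)
open import Data.Fin.Properties using (_≟_; any?; inject≤-injective; injective⇒≤)
open import Data.Fin.Subset using (Subset; _∈_)
open import Data.Fin.Subset.Properties using () renaming (_∈?_ to _∈ˢ?_)
open import Data.List using (List; []; _∷_; _++_; length; map; filter; allFin; lookup)
open import Data.List.Properties using (length-++; length-map; length-tabulate)
open import Data.List.Membership.Propositional using (_∉_; find; lose) renaming (_∈_ to _∈ˡ_)
open import Data.List.Membership.Propositional.Properties
  using (∈-lookup; ∈-map⁺; ∈-map⁻; ∈-allFin; ∈-++⁺ˡ; ∈-++⁺ʳ; ∈-++⁻; ∈-filter⁺; ∈-filter⁻)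
import Data.List.Membership.DecPropositional as DecMembership
open import Data.List.Relation.Binary.Subset.Propositional using (_⊆_)
open import Data.List.Relation.Unary.All as All using (All; []; _∷_)
open import Data.List.Relation.Unary.All.Properties using (¬Any⇒All¬; All¬⇒¬Any)
open import Data.List.Relation.Unary.AllPairs using ([]; _∷_)
open import Data.List.Relation.Unary.Any as Any using (here; there; index)
open import Data.List.Relation.Unary.Any.Properties using (lookup-index)
open import Data.List.Relation.Unary.Unique.Propositional using (Unique)
import Data.List.Relation.Unary.Unique.Propositional.Properties as Unique
open import Data.Maybe using (just; nothing)
open import Data.Maybe.Properties using (≡-dec)
open import Data.Product using (Σ; ∃; ∃₂; ∃-syntax; _×_; _,_; proj₁; proj₂)
open import Data.Refinement using (value; value-injective; _,_; Refinement-syntax)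
open import Data.Irrelevant using () renaming ([_] to irr)
open import Data.Sum using (_⊎_; inj₁; inj₂; [_,_]′)
open import Data.Unit using (tt)
open import Data.Vec using (tabulate)
open import Data.Vec.Properties using (lookup∘tabulate; lookup⇒[]=; []=⇒lookup)
open import Data.Empty using (⊥; ⊥-elim)
open import Function using (_∘_; id)
open import Function.Definitions using (Injective)
open import Function.Bundles using (mk↣; module Inverse; Injection)
open import Relation.Binary.PropositionalEquality hiding ([_])
open import Relation.Nullary
open import Relation.Nullary.Decidable using (does; recompute; decidable-stable; _×-dec_; ¬?; map′; dec-true)

-- Extremal values of undecidable predicates.

-- `P` need not be decidable, so the least element exists only under double negation. This suffices
-- wherever the goal is absurd or decidable.
¬¬-least : ∀ {P : ℕ → Set} k → P k → ¬ ¬ (∃[ m ] Least P m × m ≤ k)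
¬¬-least {P} = <-rec _ λ k rec pk ¬∃ →
  ¬∃ (k , (pk , λ j pj → ≮⇒≥ λ j<k →
    rec j<k pj λ (m , l , m≤j) → ¬∃ (m , l , ≤-trans m≤j (<⇒≤ j<k))) , ≤-refl)

-- The reflection of `d` to `b ∸ d` turns a greatest element into a least one.
¬¬-greatest : ∀ {P : ℕ → Set} b k → P k → (∀ j → P j → j ≤ b) → ¬ ¬ ∃ (Greatest P)
¬¬-greatest {P} b k pk bound ¬∃ =
  ¬¬-least {λ d → P (b ∸ d)} (b ∸ k) (subst P (sym (m∸[m∸n]≡n (bound k pk))) pk)
    λ (m , (pm , least) , _) → ¬∃ (b ∸ m , pm , λ j pj →
      subst (_≤ b ∸ m) (m∸[m∸n]≡n (bound j pj))
        (∸-monoʳ-≤ b (least (b ∸ j) (subst P (sym (m∸[m∸n]≡n (bound j pj))) pj))))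

-- Counting with duplicate-free lists.

module _ {A : Set} where

  lookup-injective : ∀ {xs : List A} → Unique xs → Injective _≡_ _≡_ (lookup xs)
  lookup-injective {_ ∷ _}  _       {Fin.zero}  {Fin.zero}  _  = refl
  lookup-injective {x ∷ xs} (p ∷ u) {Fin.zero}  {Fin.suc j} eq = ⊥-elim (All.lookup p (∈-lookup j) eq)
  lookup-injective {x ∷ xs} (p ∷ u) {Fin.suc i} {Fin.zero}  eq = ⊥-elim (All.lookup p (∈-lookup i) (sym eq))
  lookup-injective {x ∷ xs} (p ∷ u) {Fin.suc i} {Fin.suc j} eq = cong Fin.suc (lookup-injective u eq)

  unique-⊆-length : ∀ {xs ys : List A} → Unique xs → xs ⊆ ys → length xs ≤ length ys
  unique-⊆-length {xs} {ys} u sub = injective⇒≤ {f = λ i → index (sub (∈-lookup i))} λ {i} {j} eq →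
    lookup-injective u (trans (lookup-index (sub (∈-lookup i)))
      (trans (cong (lookup ys) eq) (sym (lookup-index (sub (∈-lookup j))))))

  unique-const-length : ∀ {xs : List A} → Unique xs → (∀ {x y} → x ∈ˡ xs → y ∈ˡ xs → x ≡ y) → length xs ≤ 1
  unique-const-length {[]}         _             _     = z≤n
  unique-const-length {_ ∷ []}     _             _     = s≤s z≤n
  unique-const-length {_ ∷ _ ∷ _} ((p ∷ _) ∷ _) const = ⊥-elim (p (const (here refl) (there (here refl))))

  another : ∀ {xs : List A} {x} → Unique xs → 2 ≤ length xs → x ∈ˡ xs → ∃[ y ] y ∈ˡ xs × y ≢ x
  another {y ∷ z ∷ _} ((p ∷ _) ∷ _) _ (here refl) = z , there (here refl) , p ∘ sym
  another {y ∷ z ∷ _} (p ∷ _)       _ (there m)   = y , here refl , All.lookup p m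
  another {_ ∷ []}    _ (s≤s ()) _

  -- If `xs ++ x ∷ ys` lists a cycle, then `ys ++ xs` lists the path left by removing `x`, read from
  -- just after `x`.
  unique-middle : ∀ xs {x} {ys : List A} → Unique (xs ++ x ∷ ys) → x ∉ ys ++ xs
  unique-middle xs {ys = ys} u m = [ right xs u , left xs u ]′ (∈-++⁻ ys m)
    where
    right : ∀ xs {x} {ys : List A} → Unique (xs ++ x ∷ ys) → x ∉ ys
    right []       (p ∷ _) = All¬⇒¬Any p
    right (_ ∷ xs) (_ ∷ u) = right xs u
    left : ∀ xs {x} {ys : List A} → Unique (xs ++ x ∷ ys) → x ∉ xs
    left (_ ∷ xs) (p ∷ _) (here refl) = All.lookup p (∈-++⁺ʳ xs (here refl)) refl
    left (_ ∷ xs) (_ ∷ u) (there m)   = left xs u m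

  rotate⁻ : ∀ xs {x} {ys : List A} {z} → z ∈ˡ ys ++ xs → z ∈ˡ xs ++ x ∷ ys
  rotate⁻ xs {ys = ys} m = [ ∈-++⁺ʳ xs ∘ there , ∈-++⁺ˡ ]′ (∈-++⁻ ys m)

  rotate⁺ : ∀ xs {x} {ys : List A} {z} → z ∈ˡ xs ++ x ∷ ys → z ≢ x → z ∈ˡ ys ++ xs
  rotate⁺ xs {ys = ys} m ne with ∈-++⁻ xs m
  ... | inj₁ m′          = ∈-++⁺ʳ ys m′
  ... | inj₂ (here eq)   = ⊥-elim (ne eq)
  ... | inj₂ (there m′)  = ∈-++⁺ˡ m′

  -- A list version of `AtLeast`: lists concatenate more easily than injections compose.
  Many : ℕ → (A → Set) → Set
  Many k P = ∃[ xs ] Unique xs × (∀ {x} → x ∈ˡ xs → P x) × k ≤ length xs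

  Many-mono : ∀ {k l} {P : A → Set} → k ≤ l → Many l P → Many k P
  Many-mono k≤l (xs , u , p , l≤) = xs , u , p , ≤-trans k≤l l≤

  Many⇒AtLeast : ∀ {k} {P : A → Set} → Many k P → AtLeast k P
  Many⇒AtLeast {k} (xs , u , p , k≤) =
    mk↣ {to = λ i → lookup xs (inject≤ i k≤)}
        (λ eq → inject≤-injective k≤ k≤ _ _ (lookup-injective u eq))
    , λ i → p (∈-lookup _)

  -- R is functional backwards, so the lists of R-successors are disjoint.
  Many-* : ∀ {a b} {P Q : A → Set} (R : A → A → Set) →
           (∀ {x x′ y} → P x → P x′ → R x y → R x′ y → x ≡ x′) →
           Many a P → (∀ {x} → P x → Many b (λ y → R x y × Q y)) → Many (a * b) Q
  Many-* {a} {b} {P} {Q} R fun (xs , u , p , a≤) succs =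
    let (ys , uys , q , len) = go xs u p
    in ys , uys , (proj₂ ∘ q) , ≤-trans (*-monoˡ-≤ b a≤) len
    where
    go : ∀ xs → Unique xs → (∀ {x} → x ∈ˡ xs → P x) →
         Many (length xs * b) (λ y → (∃[ x ] x ∈ˡ xs × R x y) × Q y)
    go []       _         _ = [] , [] , (λ ()) , z≤n
    go (x ∷ xs) (x∉ ∷ u) p =
      let (ys , uys , q , b≤)   = succs (p (here refl))
          (zs , uzs , q′ , len) = go xs u (p ∘ there)
      in ys ++ zs
       , Unique.++⁺ uys uzs (λ (m , m′) →
           let ((x′ , x′∈ , r′) , _) = q′ m′
           in All.lookup x∉ x′∈ (fun (p (here refl)) (p (there x′∈)) (proj₁ (q m)) r′))
       , (λ m → [ (λ m → (x , here refl , proj₁ (q m)) , proj₂ (q m))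
                , (λ m → let ((x′ , x′∈ , r′) , qy) = q′ m in (x′ , there x′∈ , r′) , qy) ]′ (∈-++⁻ ys m))
       , subst (b + length xs * b ≤_) (sym (length-++ ys)) (+-mono-≤ b≤ len)

-- Walks: joining, cutting, and deleting a vertex from a cycle.

module _ {V : Set} (G : Graph V) where

  start∈ : ∀ {k x y} (w : Walk G k x y) → x ∈ˡ vertices G w
  start∈ stop       = here refl
  start∈ (step _ _) = here refl

  end∈ : ∀ {k x y} (w : Walk G k x y) → y ∈ˡ vertices G w
  end∈ stop       = here refl
  end∈ (step _ w) = there (end∈ w)

  length-vertices : ∀ {k x y} (w : Walk G k x y) → length (vertices G w) ≡ suc k
  length-vertices stop       = refl
  length-vertices (step _ w) = cong suc (length-vertices w)

  snoc : ∀ {k a b c} → Walk G k a b → Adj G b c → Walk G (suc k) a c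
  snoc stop       e = step e stop
  snoc (step f w) e = step f (snoc w e)

  vertices-snoc : ∀ {k a b c} (w : Walk G k a b) (e : Adj G b c) →
                  vertices G (snoc w e) ≡ vertices G w ++ c ∷ []
  vertices-snoc stop       e = refl
  vertices-snoc (step f w) e = cong (_ ∷_) (vertices-snoc w e)

  ∈-snoc⁺ : ∀ {k a b c z} (w : Walk G k a b) (e : Adj G b c) → z ∈ˡ vertices G w → z ∈ˡ vertices G (snoc w e)
  ∈-snoc⁺ w e m = subst (_ ∈ˡ_) (sym (vertices-snoc w e)) (∈-++⁺ˡ m)

  ∈-snoc⁻ : ∀ {k a b c z} (w : Walk G k a b) (e : Adj G b c) → z ∈ˡ vertices G (snoc w e) →
            z ∈ˡ vertices G w ⊎ z ≡ c
  ∈-snoc⁻ w e m = [ inj₁ , (λ { (here eq) → inj₂ eq }) ]′ (∈-++⁻ _ (subst (_ ∈ˡ_) (vertices-snoc w e) m))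

  unique-snoc : ∀ {k a b c} (w : Walk G k a b) (e : Adj G b c) →
                Unique (vertices G w) → c ∉ vertices G w → Unique (vertices G (snoc w e))
  unique-snoc w e u c∉ = subst Unique (sym (vertices-snoc w e))
    (Unique.++⁺ u ([] ∷ []) (λ { (m , here refl) → c∉ m }))

  join : ∀ {i j a b c d} → Walk G i a b → Adj G b c → Walk G j c d → Walk G (suc (i + j)) a d
  join stop       e w = step e w
  join (step f u) e w = step f (join u e w)

  vertices-join : ∀ {i j a b c d} (u : Walk G i a b) (e : Adj G b c) (w : Walk G j c d) →
                  vertices G (join u e w) ≡ vertices G u ++ vertices G w
  vertices-join stop       e w = refl
  vertices-join (step f u) e w = cong (_ ∷_) (vertices-join u e w)

  reverse : ∀ {k x y} (w : Walk G k x y) → Σ (Walk G k y x) λ w′ → vertices G w′ ⊆ vertices G w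
  reverse stop = stop , id
  reverse (step e w) =
    let (w′ , sub) = reverse w
    in snoc w′ (symAdj G e) , [ there ∘ sub , here ]′ ∘ ∈-snoc⁻ w′ (symAdj G e)

  split : ∀ {k x y z} (w : Walk G k x y) → z ∈ˡ vertices G w →
          ∃₂ λ i j → i + j ≡ k × Σ (Walk G i x z) λ u → Σ (Walk G j z y) λ u′ →
            vertices G u ⊆ vertices G w × vertices G u′ ⊆ vertices G w
  split stop       (here refl) = 0 , 0 , refl , stop , stop , id , id
  split (step e w) (here refl) =
    0 , _ , refl , stop , step e w , (λ { (here refl) → here refl }) , id
  split (step e w) (there m) with split w m
  ... | i , j , eq , u , u′ , s , s′ =
    suc i , j , cong suc eq , step e u , u′
    , (λ { (here refl) → here refl ; (there m) → there (s m) }) , there ∘ s′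

  -- The cut is just before `z`; the leading edge `e` guarantees a predecessor `p` to end the first
  -- piece.
  cut : ∀ {k a x y z} (e : Adj G a x) (w : Walk G k x y) → z ∈ˡ vertices G w →
        ∃₂ λ i j → ∃[ p ] Σ (Walk G i a p) λ u → Adj G p z × Σ (Walk G j z y) λ u′ →
          vertices G (step e w) ≡ vertices G u ++ vertices G u′
  cut e stop       (here refl) = 0 , 0 , _ , stop , e , stop , refl
  cut e (step f w) (here refl) = 0 , _ , _ , stop , e , step f w , refl
  cut e (step f w) (there m) with cut f w m
  ... | i , j , p , u , g , u′ , eq = suc i , j , p , step e u , g , u′ , cong (_ ∷_) eq

  delete : ∀ {k a b x} (w : Walk G (suc k) a b) → Unique (vertices G w) → Adj G b a → x ∈ˡ vertices G w →
           ∃[ j ] ∃₂ λ c d → Σ (Walk G j c d) λ w′ → vertices G w′ ⊆ vertices G w × x ∉ vertices G w′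
             × (∀ {z} → z ∈ˡ vertices G w → z ≢ x → z ∈ˡ vertices G w′)
  delete (step e w) (x∉ ∷ _) f (here refl) =
    _ , _ , _ , w , there , All¬⇒¬Any x∉ , λ { (here refl) ne → ⊥-elim (ne refl) ; (there m) _ → m }
  delete (step e w) u f (there m) with cut e w m
  ... | i , j , p , w₁ , g , stop , eq = _ , _ , _ , w₁
      , subst (_ ⊆_) (sym eq) (rotate⁻ (vertices G w₁))
      , unique-middle (vertices G w₁) (subst Unique eq u)
      , λ m → rotate⁺ (vertices G w₁) (subst (_ ∈ˡ_) eq m)
  -- For an inner `x`, the closing edge `f` leads from the piece after `x` to the piece before it.
  ... | i , j , p , w₁ , g , step h w₂ , eq = _ , _ , _ , join w₂ f w₁
      , subst₂ _⊆_ (sym (vertices-join w₂ f w₁)) (sym eq) (rotate⁻ (vertices G w₁))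
      , subst (_ ∉_) (sym (vertices-join w₂ f w₁)) (unique-middle (vertices G w₁) (subst Unique eq u))
      , λ m ne → subst (_ ∈ˡ_) (sym (vertices-join w₂ f w₁))
                   (rotate⁺ (vertices G w₁) (subst (_ ∈ˡ_) eq m) ne)

  -- A return to the starting vertex could be cut off, leaving a shorter walk; tails of shortest
  -- walks are again shortest.
  shortest-unique : ∀ {k x y} (w : Walk G k x y) → (∀ j → Walk G j x y → k ≤ j) → Unique (vertices G w)
  shortest-unique stop       _     = [] ∷ []
  shortest-unique {suc k} (step e w) short =
    ¬Any⇒All¬ _ (λ m → let (i , j , eq , _ , u , _) = split w m
                        in <⇒≱ (s≤s (subst (j ≤_) eq (m≤n+m j i))) (short j u))
    ∷ shortest-unique w (λ j u → s≤s⁻¹ (short (suc j) (step e u)))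

  append : ∀ {i j x y z} → Walk G i x y → Walk G j y z → ∃[ k ] Walk G k x z
  append stop       u = _ , u
  append (step e w) u = _ , step e (proj₂ (append w u))

  spanning-walk-connected : ∀ {k a b} (w : Walk G k a b) → (∀ x → x ∈ˡ vertices G w) → Connected G
  spanning-walk-connected {a = a} w all x y =
    append (proj₁ (reverse (from-start x))) (from-start y)
    where
    from-start : ∀ x → Walk G (proj₁ (split w (all x))) a x
    from-start x = let (_ , _ , _ , u , _) = split w (all x) in u

-- Transfer of walks to induced subgraphs.

module _ {V W : Set} {G : Graph V} {Γ : Graph W} (val : W → V)
         (val-injective : ∀ {a b} → val a ≡ val b → a ≡ b)
         (adj : ∀ {a b} → Adj G (val a) (val b) → Adj Γ a b) where

  -- `val` is abstract to serve both `G [ S ]`, with `value`, and that graph minus a vertex, with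
  -- `value ∘ value`.
  lift-walk : ∀ {k x y} (w : Walk G k x y) → (∀ {z} → z ∈ˡ vertices G w → ∃[ Z ] val Z ≡ z) →
              ∀ {X Y} → val X ≡ x → val Y ≡ y →
              Σ (Walk Γ k X Y) λ w′ → map val (vertices Γ w′) ≡ vertices G w
  lift-walk stop _ refl q with val-injective q
  ... | refl = stop , refl
  lift-walk (step e w) ran refl q with ran (there (start∈ G w))
  ... | Z , refl with lift-walk w (ran ∘ there) {Z} refl q
  ... | w′ , eq = step (adj e) w′ , cong (_ ∷_) eq

  lift-connected : ∀ {k x y} (w : Walk G k x y) → (∀ {z} → z ∈ˡ vertices G w → ∃[ Z ] val Z ≡ z) →
                   (∀ X → val X ∈ˡ vertices G w) → Connected Γ
  lift-connected w ran all =
    let (w′ , eq) = lift-walk w ran (proj₂ (ran (start∈ G w))) (proj₂ (ran (end∈ G w)))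
    in spanning-walk-connected Γ w′ λ X →
         let (Z , Z∈ , eq′) = ∈-map⁻ val (subst (val X ∈ˡ_) (sym eq) (all X))
         in subst (_∈ˡ _) (sym (val-injective eq′)) Z∈

-- Even cycles as degree-choosable components.

module _ {n : ℕ} where

  open DecMembership (_≟_ {n}) using (_∈?_)

  fromList : List (Fin n) → Subset n
  fromList xs = tabulate (λ i → does (i ∈? xs))

  ∈-fromList⁺ : ∀ {x xs} → x ∈ˡ xs → x ∈ fromList xs
  ∈-fromList⁺ {x} {xs} m = lookup⇒[]= x _ (trans (lookup∘tabulate _ x) (dec-true (x ∈? xs) m))

  ∈-fromList⁻ : ∀ {x xs} → x ∈ fromList xs → x ∈ˡ xs
  ∈-fromList⁻ {x} {xs} m with x ∈? xs | trans (sym (lookup∘tabulate (λ i → does (i ∈? xs)) x)) ([]=⇒lookup m)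
  ... | yes p | _ = p

  -- The cycle is a walk without repetition plus a closing edge. It has `suc (suc k)` vertices, at
  -- least three by `1 ≤ k`; chords are allowed.
  module EvenCycle (G : Graph (Fin n)) {k a b} (w : Walk G (suc k) a b) (u : Unique (vertices G w))
                   (closed : Adj G b a) (even : 2 ∣ suc (suc k)) (1≤k : 1 ≤ k) where

    L : List (Fin n)
    L = vertices G w

    S : Subset n
    S = fromList L

    Γ : Graph [ x ∈ Fin n ∣ x ∈ S ]
    Γ = G [ S ]

    mem : ∀ {x} → x ∈ˡ L → [ x ∈ Fin n ∣ x ∈ S ]
    mem {x} m = x , irr (∈-fromList⁺ m)

    mem⁻ : (X : [ x ∈ Fin n ∣ x ∈ S ]) → value X ∈ˡ L
    -- The membership proof in a refinement is irrelevant; decidability recovers a usable one.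
    mem⁻ (x , irr p) = ∈-fromList⁻ (recompute (x ∈ˢ? S) p)

    w′ : Walk Γ (suc k) (mem (start∈ G w)) (mem (end∈ G w))
    w′ = proj₁ (lift-walk value value-injective id w (λ m → mem m , refl) refl refl)

    map-w′ : map value (vertices Γ w′) ≡ L
    map-w′ = proj₂ (lift-walk value value-injective id w (λ m → mem m , refl) refl refl)

    u′ : Unique (vertices Γ w′)
    u′ = Unique.map⁻ (subst Unique (sym map-w′) u)

    all′ : ∀ X → X ∈ˡ vertices Γ w′
    all′ X = let (Z , Z∈ , eq) = ∈-map⁻ value (subst (_ ∈ˡ_) (sym map-w′) (mem⁻ X))
             in subst (_∈ˡ _) (sym (value-injective eq)) Z∈

    -- A cycle minus one vertex is still spanned by a walk.
    connected-minus : ∀ X → Connected (induced Γ (_≢ X))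
    connected-minus X =
      let (_ , _ , _ , w″ , sub , x∉ , keep) = delete G w u closed (mem⁻ X)
      in lift-connected {G = G} (value ∘ value) (value-injective ∘ value-injective) id w″
           (λ m → (mem (sub m) , irr (λ eq → x∉ (subst (_∈ˡ _) (cong value eq) m))) , refl)
           (λ { (Z , irr Z≢X) → keep (mem⁻ Z)
                  (recompute (¬? (value Z ≟ value X)) (λ eq → Z≢X (value-injective eq))) })

    twoConnected : TwoConnected Γ
    twoConnected =
      Many⇒AtLeast (vertices Γ w′ , u′ , (λ _ → tt) , subst (3 ≤_) (sym (length-vertices Γ w′)) 3≤)
      , spanning-walk-connected Γ w′ all′
      , connected-minus
      where
      3≤ : 3 ≤ suc (suc k)
      3≤ = s≤s (s≤s 1≤k)

    -- An isomorphism preserves the number of vertices, which is even here.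
    ¬oddCycle : ¬ IsOddCycle Γ
    ¬oddCycle (j , odd , _ , f , _) = odd (subst (2 ∣_) (sym j≡) even)
      where
      to = Inverse.to f
      fL = map to (vertices Γ w′)
      len : length fL ≡ suc (suc k)
      len = trans (length-map to (vertices Γ w′)) (length-vertices Γ w′)
      j≡ : j ≡ suc (suc k)
      j≡ = ≤-antisym
        (subst₂ _≤_ (length-tabulate id) len
          (unique-⊆-length (Unique.allFin⁺ j) λ {i} _ →
            subst (_∈ˡ fL) (Inverse.strictlyInverseˡ f i) (∈-map⁺ to (all′ (Inverse.from f i)))))
        (subst₂ _≤_ len (length-tabulate id)
          (unique-⊆-length (Unique.map⁺ {f = to} (λ {x} {y} eq →
             trans (sym (Inverse.strictlyInverseʳ f x))
               (trans (cong (Inverse.from f) eq) (Inverse.strictlyInverseʳ f y))) u′)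
             (λ _ → ∈-allFin _)))

    -- The eccentricity of the single vertex `c` already bounds the radius.
    ¬¬-radius : ∀ {r c} → c ∈ˡ L →
                (∀ {z} → z ∈ˡ L → ∃[ d ] d ≤ r × Σ (Walk G d c z) λ q → vertices G q ⊆ L) →
                ¬ ¬ (∃[ ρ ] Radius Γ ρ × ρ ≤ r)
    ¬¬-radius {r} c∈ reach ¬ρ =
      -- Distance 0 is attained at `c` itself, so the bounded set of distances is nonempty.
      ¬¬-greatest r 0 (mem c∈ , stop , λ _ _ → z≤n) bound λ (e , ecc) →
        ¬¬-least e (mem c∈ , ecc) λ (ρ , least , ρ≤e) →
          ¬ρ (ρ , least , ≤-trans ρ≤e (bound e (proj₁ ecc)))
      where
      bound : ∀ d → (∃[ X ] Distance Γ (mem c∈) X d) → d ≤ r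
      bound d (X , _ , least) =
        let (d′ , d′≤ , q , sub) = reach (mem⁻ X)
        in ≤-trans (least d′ (proj₁ (lift-walk value value-injective id q (λ m → mem (sub m) , refl) refl refl))) d′≤

    -- The nonadjacent pair excludes a clique, parity excludes an odd cycle, and `reach` bounds the
    -- radius.
    contradiction-DCC : ∀ {r c} → NoDCCOfRadiusAtMost G r →
      ∀ {x y} → x ∈ˡ L → y ∈ˡ L → x ≢ y → ¬ Adj G x y →
      c ∈ˡ L → (∀ {z} → z ∈ˡ L → ∃[ d ] d ≤ r × Σ (Walk G d c z) λ q → vertices G q ⊆ L) → ⊥
    contradiction-DCC noDCC x∈ y∈ x≢y ¬xy c∈ reach = ¬¬-radius c∈ reach λ (ρ , rad , ρ≤) →
      noDCC S ρ (twoConnected , (λ clique → ¬xy (clique (mem x∈) (mem y∈) (x≢y ∘ cong value))) , ¬oddCycle)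
        rad ρ≤

    -- On a cycle of length at most 2r, one of the two directions reaches any vertex within `r`
    -- steps.
    contradiction-short : ∀ {r} → NoDCCOfRadiusAtMost G r → suc (suc k) ≤ r + r →
      ∀ {x y} → x ∈ˡ L → y ∈ˡ L → x ≢ y → ¬ Adj G x y → ⊥
    contradiction-short {r} noDCC k≤ x∈ y∈ x≢y ¬xy =
      contradiction-DCC noDCC x∈ y∈ x≢y ¬xy (start∈ G w) reach
      where
      reach : ∀ {z} → z ∈ˡ L → ∃[ d ] d ≤ r × Σ (Walk G d a z) λ q → vertices G q ⊆ L
      reach m with split G w m
      ... | i , j , eq , q , q′ , sub , sub′ with i ≤? r
      ... | yes i≤r = i , i≤r , q , sub
      -- The way back through the closing edge has length `suc j`, and `i + suc j` is the length of
      -- the cycle.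
      ... | no  i≰r = suc j , ≮⇒≥ (λ r<j → <⇒≱ (+-mono-<-≤ (≰⇒> i≰r) (<⇒≤ r<j))
                         (≤-trans (≤-reflexive (trans (+-suc i j) (cong suc eq))) k≤))
                    , step (symAdj G closed) (proj₁ (reverse G q′))
                    , λ { (here refl) → start∈ G w ; (there m) → sub′ (proj₂ (reverse G q′) m) }

  -- Cliques with more than Δ nodes.

  neighbours : Graph (Fin n) → Fin n → List (Fin n)
  neighbours G x = filter (adj? G x) (allFin n)

  -- The clique uses up the degree of each of its nodes, so no edge leaves it and connectedness
  -- makes it all of `G`.
  large-clique⇒clique : (G : Graph (Fin n)) (Δ : ℕ) → MaxDegree G Δ → Connected G →
    ∀ {xs} → Unique xs → (∀ {x y} → x ∈ˡ xs → y ∈ˡ xs → x ≢ y → Adj G x y) → suc Δ ≤ length xs → IsClique G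
  large-clique⇒clique G Δ (_ , max) conn {xs = x₀ ∷ xs′} u clique len = λ x y → clique (all x) (all y)
    where
    xs = x₀ ∷ xs′
    closed : ∀ {x y} → x ∈ˡ xs → Adj G x y → y ∈ˡ xs
    closed {x} {y} x∈ xy with y ∈? xs
    ... | yes y∈ = y∈
    ... | no  y∉ = ⊥-elim (<⇒≱ (s≤s (s≤s (max _ (x , refl)))) (≤-trans (s≤s len)
            (unique-⊆-length {ys = x ∷ neighbours G x} (¬Any⇒All¬ _ y∉ ∷ u) sub)))
      where
      sub : y ∷ xs ⊆ x ∷ neighbours G x
      sub (here refl) = there (∈-filter⁺ (adj? G x) (∈-allFin _) xy)
      sub {z} (there z∈) with x ≟ z
      ... | yes refl = here refl
      ... | no  x≢z  = there (∈-filter⁺ (adj? G x) (∈-allFin _) (clique x∈ z∈ x≢z))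
    along : ∀ {k x y} → Walk G k x y → x ∈ˡ xs → y ∈ˡ xs
    along stop       x∈ = x∈
    along (step e w) x∈ = along w (closed x∈ e)
    all : ∀ x → x ∈ˡ xs
    all x = along (proj₂ (conn x₀ x)) (here refl)

-- Breadth-first levels of the unmarked graph and forks in its tree.

module Levels {n} (G : Graph (Fin n)) (χ : Colouring n) (v : Fin n) (Uv : χ v ≡ nothing) where

  U : Fin n → Set
  U u = χ u ≡ nothing

  U? : ∀ u → Dec (U u)
  U? u = ≡-dec ℕ._≟_ (χ u) nothing

  -- Walks of length `k` from `v` in the unmarked graph, phrased on nodes of `G` and by recursion so
  -- that they are decidable.
  Reach : ℕ → Fin n → Set
  Reach zero    u = u ≡ v
  Reach (suc k) u = U u × ∃[ w ] Reach k w × Adj G w u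

  reach? : ∀ k u → Dec (Reach k u)
  reach? zero    u = u ≟ v
  reach? (suc k) u = U? u ×-dec any? (λ w → reach? k w ×-dec adj? G w u)

  Reach⇒U : ∀ {k u} → Reach k u → U u
  Reach⇒U {zero}  refl    = Uv
  Reach⇒U {suc _} (u , _) = u

  Lev : ℕ → Fin n → Set
  Lev k u = Least (λ j → Reach j u) k

  abstract
    lev? : ∀ k u → Dec (Lev k u)
    lev? k u = map′ (λ (p , ¬∃) → p , λ j q → ≮⇒≥ (λ j<k → ¬∃ (j , j<k , q)))
                    (λ (p , least) → p , λ (j , j<k , q) → <⇒≱ j<k (least j q))
                    (reach? k u ×-dec ¬? (anyUpTo? (λ j → reach? j u) k))

  lev-v : Lev 0 v
  lev-v = refl , λ _ _ → z≤n

  Lev⇒U : ∀ {k u} → Lev k u → U u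
  Lev⇒U (p , _) = Reach⇒U p

  lev-unique : ∀ {i j u} → Lev i u → Lev j u → i ≡ j
  lev-unique (p , l) (q , m) = ≤-antisym (l _ q) (m _ p)

  -- Decidability of `Reach` yields an actual minimum, without double negation.
  level : ∀ k {u} → Reach k u → ∃[ j ] j ≤ k × Lev j u
  level = <-rec _ λ k rec {u} p → go k rec p (anyUpTo? (λ j → reach? j u) k)
    where
    go : ∀ k → (∀ {j} → j < k → ∀ {u} → Reach j u → ∃[ i ] i ≤ j × Lev i u) →
         ∀ {u} → Reach k u → Dec (∃ λ j → j < k × Reach j u) → ∃[ j ] j ≤ k × Lev j u
    go k rec p (yes (j , j<k , q)) =
      let (i , i≤j , l) = rec j<k q in i , ≤-trans i≤j (<⇒≤ j<k) , l
    go k rec p (no ¬∃) = k , ≤-refl , p , λ j q → ≮⇒≥ (λ j<k → ¬∃ (j , j<k , q))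

  lev-adj : ∀ {i j x y} → Lev i x → Lev j y → Adj G x y → j ≤ suc i
  lev-adj (p , _) (q , least) xy = least _ (Reach⇒U q , _ , p , xy)

  parent : ∀ {k u} → Lev (suc k) u → ∃[ w ] Lev k w × Adj G w u
  parent ((Uu , w , p , wu) , least) = w , (p , λ j q → s≤s⁻¹ (least (suc j) (Uu , w , q , wu))) , wu

  data NeighbourLevel : ℕ → Fin n → Set where
    up   : ∀ {t y} → Lev t y → NeighbourLevel (suc t) y
    same : ∀ {t y} → Lev t y → NeighbourLevel t y
    down : ∀ {t y} → Lev (suc t) y → NeighbourLevel t y

  -- The edge bounds each level by one more than the other.
  neighbour-level : ∀ {t x y} → Lev t x → Adj G x y → U y → NeighbourLevel t y
  neighbour-level {t} {x} {y} lx xy Uy with level (suc t) {y} (Uy , x , proj₁ lx , xy)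
  ... | j , j≤ , ly with m≤n⇒m<n∨m≡n j≤
  ... | inj₂ refl = down ly
  ... | inj₁ j< with m≤n⇒m<n∨m≡n (s≤s⁻¹ j<)
  ... | inj₂ refl = same ly
  ... | inj₁ j<t with ≤-antisym j<t (lev-adj ly lx (symAdj G xy))
  ... | refl = up ly

  -- The tree path from p up to the first common ancestor and down to p′, both on level t.
  record Fork (t : ℕ) (p p′ : Fin n) : Set where
    field
      height  : ℕ
      height≤ : height ≤ t
      walk    : Walk G (height * 2) p p′
      unique  : Unique (vertices G walk)
      below   : ∀ {z} → z ∈ˡ vertices G walk → z ≡ p ⊎ z ≡ p′ ⊎ (∃[ i ] i < t × Lev i z)

    -- With `not-beside`, this keeps the cycle simple when further nodes on level `t` or higher
    -- close the walk.
    not-above : ∀ {i z} → Lev t p → Lev t p′ → Lev i z → t < i → z ∉ vertices G walk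
    not-above lp lp′ lz t<i m with below m
    ... | inj₁ refl                   = <-irrefl (lev-unique lp lz) t<i
    ... | inj₂ (inj₁ refl)            = <-irrefl (lev-unique lp′ lz) t<i
    ... | inj₂ (inj₂ (j , j<t , lz′)) = <-asym t<i (subst (_< _) (lev-unique lz′ lz) j<t)

    not-beside : ∀ {z} → Lev t z → z ≢ p → z ≢ p′ → z ∉ vertices G walk
    not-beside lz z≢p z≢p′ m with below m
    ... | inj₁ eq                     = z≢p eq
    ... | inj₂ (inj₁ eq)              = z≢p′ eq
    ... | inj₂ (inj₂ (j , j<t , lz′)) = <-irrefl (lev-unique lz′ lz) j<t

  -- Separate from `fork` because the cycles built later need `q` and `q′` on the walk and a
  -- positive height.
  fork-suc : ∀ {t p p′ q q′} → Lev (suc t) p → Lev (suc t) p′ → p ≢ p′ → Lev t q → Lev t q′ →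
             Adj G q p → Adj G q′ p′ → Fork t q q′ →
             Σ (Fork (suc t) p p′) λ F → 1 ≤ Fork.height F
               × q ∈ˡ vertices G (Fork.walk F) × q′ ∈ˡ vertices G (Fork.walk F)
  fork-suc {t} {p} {p′} {q} {q′} lp lp′ p≢p′ lq lq′ qp q′p′ F =
    record
      { height = suc height ; height≤ = s≤s height≤ ; walk = step (symAdj G qp) (snoc G walk q′p′)
      ; unique = ¬Any⇒All¬ _ (λ m → [ not-above lq lq′ lp ≤-refl , p≢p′ ]′ (∈-snoc⁻ G walk q′p′ m))
                 ∷ unique-snoc G walk q′p′ unique (not-above lq lq′ lp′ ≤-refl)
      ; below = λ { (here eq) → inj₁ eq
                  ; (there m) → [ inj₂ ∘ inj₂ ∘ low , inj₂ ∘ inj₁ ]′ (∈-snoc⁻ G walk q′p′ m) }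
      }
    , s≤s z≤n , there (∈-snoc⁺ G walk q′p′ (start∈ G walk)) , there (∈-snoc⁺ G walk q′p′ (end∈ G walk))
    where
    open Fork F
    low : ∀ {z} → z ∈ˡ vertices G walk → ∃[ i ] i < suc t × Lev i z
    low m with below m
    ... | inj₁ refl                  = t , ≤-refl , lq
    ... | inj₂ (inj₁ refl)           = t , ≤-refl , lq′
    ... | inj₂ (inj₂ (i , i<t , lz)) = i , m≤n⇒m≤1+n i<t , lz

  fork : ∀ t {p p′} → Lev t p → Lev t p′ → Fork t p p′
  fork t {p} {p′} lp lp′ with p ≟ p′
  ... | yes refl = record { height = 0 ; height≤ = z≤n ; walk = stop ; unique = [] ∷ []
                          ; below = λ { (here eq) → inj₁ eq } }
  fork zero    (lp , _) (lp′ , _) | no p≢p′ = ⊥-elim (p≢p′ (trans lp (sym lp′)))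
  fork (suc t) lp lp′ | no p≢p′ =
    let (q , lq , qp)    = parent lp
        (q′ , lq′ , q′p′) = parent lp′
    in proj₁ (fork-suc lp lp′ p≢p′ lq lq′ qp q′p′ (fork t lq lq′))

double-≤ : ∀ {m r} → m ≤ r → m * 2 ≤ r + r
double-≤ {m} {r} m≤r =
  subst (_≤ r + r) (trans (cong (m +_) (sym (+-identityʳ m))) (*-comm 2 m)) (+-mono-≤ m≤r m≤r)

-- With `n` = Δ-2 and q = `suc k` this is the bound q(Δ-1-q) ≥ Δ-2 for cliques of q children.
n≤1+k*[n∸k] : ∀ k n → k < n → n ≤ suc k * (n ∸ k)
n≤1+k*[n∸k] k n k<n = begin
  n                    ≡⟨ sym (m∸n+n≡m (<⇒≤ k<n)) ⟩
  n ∸ k + k            ≤⟨ +-monoʳ-≤ (n ∸ k) (≤-trans (≤-reflexive (sym (*-identityʳ k))) (*-monoʳ-≤ k (m<n⇒0<n∸m k<n))) ⟩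
  n ∸ k + k * (n ∸ k)  ∎
  where open ≤-Reasoning

-- Configurations excluded from the tree by short even cycles.

module Tree {n} (G : Graph (Fin n)) (r Δ : ℕ) (nice : Nice G) (maxΔ : MaxDegree G Δ) (4≤Δ : 4 ≤ Δ)
            (noDCC : NoDCCOfRadiusAtMost G r) (χ : Colouring n) (marking : MarkingOutcome G 6 χ)
            (v : Fin n) (Uv : χ v ≡ nothing) where

  open Levels G χ v Uv
  open MarkingOutcome marking

  -- The chord `b d` may be present: one nonadjacent pair suffices to exclude a clique.
  no-C₄ : ∀ {a b c d} → 2 ≤ r → Adj G a b → Adj G b c → Adj G c d → Adj G d a →
          a ≢ c → b ≢ d → ¬ Adj G a c → ⊥
  no-C₄ 2≤r ab bc cd da a≢c b≢d ¬ac =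
    contradiction-short noDCC (+-mono-≤ 2≤r 2≤r) (here refl) (there (there (here refl))) a≢c ¬ac
    where
    ne : ∀ {x y} → Adj G x y → x ≢ y
    ne xy eq = irrefl G eq xy
    open EvenCycle G (step ab (step bc (step cd stop)))
      ((ne ab ∷ a≢c ∷ ne da ∘ sym ∷ []) ∷ (ne bc ∷ b≢d ∷ []) ∷ (ne cd ∷ []) ∷ [] ∷ []) da
      (divides 2 refl) (s≤s z≤n)
      using (L; contradiction-short)

  -- Two parents close a fork into an even cycle of length at most 2r. It is no clique, since the
  -- grandparent `q` lies two levels above `u`.
  unique-parent : ∀ {s u p p′} → suc s ≤ r → Lev (suc s) u → Lev s p → Lev s p′ →
                  Adj G p u → Adj G p′ u → p ≡ p′
  unique-parent {s} {u} {p} {p′} s<r lu lp lp′ pu p′u with p ≟ p′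
  ... | yes eq = eq
  unique-parent {zero}  _ _ (lp , _) (lp′ , _) _ _ | no p≢p′ = ⊥-elim (p≢p′ (trans lp (sym lp′)))
  unique-parent {suc s} {u} s<r lu lp lp′ pu p′u | no p≢p′ with parent lp | parent lp′
  ... | q , lq , qp | q′ , lq′ , q′p′ with fork-suc lp lp′ p≢p′ lq lq′ qp q′p′ (fork s lq lq′)
  ... | F , 1≤h , q∈ , _ = ⊥-elim (contradiction-short noDCC (double-≤ (≤-trans (s≤s height≤) s<r))
          (∈-snoc⁺ G walk p′u q∈) (end∈ G (snoc G walk p′u))
          (λ { refl → <-irrefl (lev-unique lq lu) (m≤n⇒m≤1+n ≤-refl) })
          (λ qu → <-irrefl refl (lev-adj lq lu qu)))
    where
    open Fork F
    open EvenCycle G (snoc G walk p′u) (unique-snoc G walk p′u unique (not-above lp lp′ lu ≤-refl))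
      (symAdj G pu) (divides (suc height) refl) (≤-trans 1≤h (m≤m*n height 2))
      using (L; contradiction-short)

  -- The fork of `w` and `w′` closed through `x` is an even cycle of length at most 2r, so its nodes
  -- are pairwise adjacent. In particular `q′` is adjacent to `w`, which has only one parent.
  same-level-neighbours : ∀ {t x w w′ q q′} → suc (suc t) ≤ r →
    Lev (suc t) x → Lev (suc t) w → Lev (suc t) w′ → Adj G x w → Adj G x w′ → w ≢ w′ →
    Lev t q → Lev t q′ → Adj G q w → Adj G q′ w′ → q ≡ q′ × Adj G q x × Adj G w w′
  same-level-neighbours {t} {x} {w} {w′} {q} {q′} t<r lx lw lw′ xw xw′ w≢w′ lq lq′ qw q′w′
    with fork-suc lw lw′ w≢w′ lq lq′ qw q′w′ (fork t lq lq′)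
  ... | F , 1≤h , q∈ , q′∈ = q≡q′ , qx , ww′
    where
    open Fork F
    w′x = symAdj G xw′
    open EvenCycle G (snoc G walk w′x)
      (unique-snoc G walk w′x unique (not-beside lx (λ eq → irrefl G eq xw) (λ eq → irrefl G eq xw′)))
      xw (divides (suc height) refl) (≤-trans 1≤h (m≤m*n height 2))
      using (L; contradiction-short)
    adjacent : ∀ {a b} → a ∈ˡ L → b ∈ˡ L → a ≢ b → Adj G a b
    adjacent a∈ b∈ a≢b = decidable-stable (adj? G _ _)
      (contradiction-short noDCC (double-≤ (≤-trans (s≤s height≤) t<r)) a∈ b∈ a≢b)
    w∈  = start∈ G (snoc G walk w′x)
    w′∈ = ∈-snoc⁺ G walk w′x (end∈ G walk)
    x∈  = end∈ G (snoc G walk w′x)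
    differ : ∀ {a b} → Lev t a → Lev (suc t) b → a ≢ b
    differ la lb refl = <-irrefl (lev-unique la lb) ≤-refl
    q≡q′ : q ≡ q′
    q≡q′ = unique-parent (<⇒≤ t<r) lw lq lq′ qw
      (adjacent (∈-snoc⁺ G walk w′x q′∈) w∈ (differ lq′ lw))
    qx : Adj G q x
    qx = adjacent (∈-snoc⁺ G walk w′x q∈) x∈ (differ lq lx)
    ww′ : Adj G w w′
    ww′ = adjacent w∈ w′∈ w≢w′

  -- The fork from `y` to `x′` continues through `w`, `c`, `x` back to `y`; its height is 0 if `y`
  -- equals `x′`. An edge `y c` would give `c` a second parent.
  no-cousins : ∀ {t x x′ y c w} → suc (suc t) ≤ r →
    Lev t x → Lev t x′ → Lev t y → Lev (suc t) c → Lev (suc t) w →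
    Adj G x c → Adj G x′ w → Adj G c w → Adj G x y → x ≢ x′ → ⊥
  no-cousins {t} {x} {x′} {y} {c} {w} t<r lx lx′ ly lc lw xc x′w cw xy x≢x′ =
    contradiction-short noDCC (double-≤ (≤-trans (s≤s (s≤s height≤)) t<r))
      (start∈ G cycle) (∈-snoc⁺ G walk₂ cx (end∈ G walk₂))
      (λ { refl → <-irrefl (lev-unique ly lc) ≤-refl })
      (λ yc → irrefl G (unique-parent (<⇒≤ t<r) lc lx ly xc yc) xy)
    where
    F = fork t ly lx′
    open Fork F
    wc = symAdj G cw
    cx = symAdj G xc
    walk₁ = snoc G walk x′w
    walk₂ = snoc G walk₁ wc
    cycle = snoc G walk₂ cx
    c≢w : c ≢ w
    c≢w eq = irrefl G eq cw
    x≢ : ∀ {z} → Lev (suc t) z → x ≢ z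
    x≢ lz refl = <-irrefl (lev-unique lx lz) ≤-refl
    open EvenCycle G cycle
      (unique-snoc G walk₂ cx
        (unique-snoc G walk₁ wc
          (unique-snoc G walk x′w unique (not-above ly lx′ lw ≤-refl))
          (λ m → [ not-above ly lx′ lc ≤-refl , c≢w ]′ (∈-snoc⁻ G walk x′w m)))
        (λ m → [ (λ m → [ not-beside lx (λ eq → irrefl G eq xy) x≢x′ , x≢ lw ]′ (∈-snoc⁻ G walk x′w m))
               , x≢ lc ]′ (∈-snoc⁻ G walk₁ wc m)))
      xy (divides (suc (suc height)) refl) (s≤s z≤n)
      using (L; contradiction-short)

  -- Neighbours sorted by mark and level.

  marked : Fin n → List (Fin n)
  marked x = filter (λ y → adj? G x y ×-dec ¬? (U? y)) (allFin n)

  -- For `x` on level `t`, the argument `suc t` gives its children and `t` its neighbours on the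
  -- same level.
  at-level : ℕ → Fin n → List (Fin n)
  at-level t x = filter (λ y → adj? G x y ×-dec lev? t y) (allFin n)

  unique-at-level : ∀ t x → Unique (at-level t x)
  unique-at-level t x = Unique.filter⁺ (λ y → adj? G x y ×-dec lev? t y) (Unique.allFin⁺ n)

  ∈-at-level⁺ : ∀ {t x y} → Adj G x y → Lev t y → y ∈ˡ at-level t x
  ∈-at-level⁺ {t} {x} xy ly = ∈-filter⁺ (λ y → adj? G x y ×-dec lev? t y) (∈-allFin _) (xy , ly)

  ∈-at-level⁻ : ∀ {t x y} → y ∈ˡ at-level t x → Adj G x y × Lev t y
  ∈-at-level⁻ {t} {x} m = proj₂ (∈-filter⁻ (λ y → adj? G x y ×-dec lev? t y) {xs = allFin n} m)

  ∈-marked⁺ : ∀ {x y} → Adj G x y → ¬ U y → y ∈ˡ marked x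
  ∈-marked⁺ {x} xy ¬Uy = ∈-filter⁺ (λ y → adj? G x y ×-dec ¬? (U? y)) (∈-allFin _) (xy , ¬Uy)

  ∈-marked⁻ : ∀ {x y} → y ∈ˡ marked x → Adj G x y × ¬ U y
  ∈-marked⁻ {x} m = proj₂ (∈-filter⁻ (λ y → adj? G x y ×-dec ¬? (U? y)) {xs = allFin n} m)

  1≤Δ∸2 : 1 ≤ Δ ∸ 2
  1≤Δ∸2 = ≤-trans (n≤1+n 1) (∸-monoˡ-≤ 2 4≤Δ)

  -- The invariant of the growth argument; nothing is asked on level `r`, where the tree ends.
  Good : ℕ → Fin n → Set
  Good t x = t < r → 1 ≤ length (at-level (suc t) x)

  -- Degree counts when no tree node has two marked neighbours.

  module Growth (deg : ∀ {t u} → t ≤ r → Lev t u → degree G u ≡ Δ)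
                (noT : ∀ {t u x y} → t ≤ r → Lev t u → Adj G u x → Adj G u y → ¬ U x → ¬ U y → x ≡ y) where

    marked≤1 : ∀ {t x} → t ≤ r → Lev t x → length (marked x) ≤ 1
    marked≤1 {x = x} t≤r lx =
      unique-const-length (Unique.filter⁺ (λ y → adj? G x y ×-dec ¬? (U? y)) (Unique.allFin⁺ n)) λ m m′ →
        let (xy , ¬Uy) = ∈-marked⁻ m ; (xy′ , ¬Uy′) = ∈-marked⁻ m′ in noT t≤r lx xy xy′ ¬Uy ¬Uy′

    Δ≤ : ∀ {t x ys} → t ≤ r → Lev t x → (∀ {y} → Adj G x y → y ∈ˡ ys) → Δ ≤ length ys
    Δ≤ {x = x} {ys} t≤r lx sub = subst (_≤ length ys) (deg t≤r lx)
      (unique-⊆-length (Unique.filter⁺ (adj? G x) (Unique.allFin⁺ n))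
        (λ m → sub (proj₂ (∈-filter⁻ (adj? G x) {xs = allFin n} m))))

    degree-root : ∀ {x} → Lev 0 x → Δ ≤ length (marked x) + length (at-level 1 x)
    degree-root {x} lx = subst (Δ ≤_) (length-++ (marked x)) (Δ≤ z≤n lx sub)
      where
      sub : ∀ {y} → Adj G x y → y ∈ˡ marked x ++ at-level 1 x
      sub {y} xy with U? y
      ... | no ¬Uy = ∈-++⁺ˡ (∈-marked⁺ xy ¬Uy)
      ... | yes Uy with neighbour-level lx xy Uy
      ... | same ly = ⊥-elim (irrefl G (trans (proj₁ lx) (sym (proj₁ ly))) xy)
      ... | down ly = ∈-++⁺ʳ (marked x) (∈-at-level⁺ xy ly)

    -- The `suc` accounts for the unique parent.
    degree-inner : ∀ {t x} → suc t ≤ r → Lev (suc t) x →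
      Δ ≤ suc (length (marked x) + (length (at-level (suc t) x) + length (at-level (suc (suc t)) x)))
    degree-inner {t} {x} t<r lx with parent lx
    ... | p , lp , px = ≤-trans (Δ≤ t<r lx sub) (≤-reflexive (cong suc
            (trans (length-++ (marked x)) (cong (length (marked x) +_) (length-++ (at-level (suc t) x))))))
      where
      sub : ∀ {y} → Adj G x y → y ∈ˡ p ∷ marked x ++ at-level (suc t) x ++ at-level (suc (suc t)) x
      sub {y} xy with U? y
      ... | no ¬Uy = there (∈-++⁺ˡ (∈-marked⁺ xy ¬Uy))
      ... | yes Uy with neighbour-level lx xy Uy
      ... | up ly   = here (unique-parent t<r lx ly lp (symAdj G xy) px)
      ... | same ly = there (∈-++⁺ʳ (marked x) (∈-++⁺ˡ (∈-at-level⁺ xy ly)))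
      ... | down ly = there (∈-++⁺ʳ (marked x) (∈-++⁺ʳ (at-level (suc t) x) (∈-at-level⁺ xy ly)))

    Δ∸2≤ : ∀ {t x} → suc t ≤ r → Lev (suc t) x →
      Δ ∸ 2 ≤ length (at-level (suc t) x) + length (at-level (suc (suc t)) x)
    Δ∸2≤ t<r lx = ∸-monoˡ-≤ 2 (≤-trans (degree-inner t<r lx) (s≤s (+-monoˡ-≤ _ (marked≤1 t<r lx))))

    too-large-clique : ∀ {xs} → Unique xs → (∀ {x y} → x ∈ˡ xs → y ∈ˡ xs → x ≢ y → Adj G x y) →
                       suc Δ ≤ length xs → ⊥
    too-large-clique u clique len =
      proj₂ (proj₂ (proj₂ nice)) (large-clique⇒clique G Δ maxΔ (proj₁ nice) u clique len)

    marked⇒Marked : ∀ {u} → ¬ U u → Marked u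
    marked⇒Marked {u} ¬Uu with colours u
    ... | inj₁ (m , _)  = m
    ... | inj₂ (_ , Uu) = ⊥-elim (¬Uu Uu)

    pair-of : ∀ {s x y} → StaysSelected s → pick s ≡ just (x , y) → NonAdjacentNeighbours G s x y
    pair-of {s} stays eq with pick s | picks s stays
    pair-of stays refl | just _ | pair nn = nn

    -- By the backoff distance, marked nodes at most 3 apart come from the same selected node.
    common-selector : ∀ {a y z a′} → ¬ U a → ¬ U a′ → a ≢ a′ → Adj G y a → Adj G y z → Adj G z a′ →
                      ∃[ s ] Adj G s a × Adj G s a′ × ¬ Adj G a a′
    common-selector {a} {y} {z} {a′} ¬Ua ¬Ua′ a≢a′ ya yz za′
      with marked⇒Marked ¬Ua | marked⇒Marked ¬Ua′
    ... | s , p , q , stays , eq , at | s′ , p′ , q′ , stays′ , eq′ , at′ with s ≟ s′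
    ... | no s≢s′ = ⊥-elim (¬¬-least 5 path λ (d , dist , d≤5) →
            proj₂ stays s′ (proj₁ stays′) (s≢s′ ∘ sym) (d , dist , m≤n⇒m≤1+n d≤5))
      where
      endpoint : ∀ {s p q a} → NonAdjacentNeighbours G s p q → a ≡ p ⊎ a ≡ q → Adj G s a
      endpoint (sp , _ , _) (inj₁ refl) = sp
      endpoint (_ , sq , _) (inj₂ refl) = sq
      path : Walk G 5 s s′
      path = step (endpoint (pair-of stays eq) at) (step (symAdj G ya) (step yz (step za′
               (step (symAdj G (endpoint (pair-of stays′ eq′) at′)) stop))))
    ... | yes refl with trans (sym eq) eq′
    ... | refl with pair-of stays eq | at | at′
    ... | _ , _ , _ , _         | inj₁ refl | inj₁ refl = ⊥-elim (a≢a′ refl)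
    ... | sp , sq , _ , ¬pq | inj₁ refl | inj₂ refl = s , sp , sq , ¬pq
    ... | sp , sq , _ , ¬pq | inj₂ refl | inj₁ refl = s , sq , sp , ¬pq ∘ symAdj G
    ... | _ , _ , _ , _         | inj₂ refl | inj₂ refl = ⊥-elim (a≢a′ refl)

    siblings-adjacent : ∀ {t y w w′} → suc (suc t) ≤ r → Lev (suc t) y →
      w ∈ˡ at-level (suc t) y → w′ ∈ˡ at-level (suc t) y → w ≢ w′ → Adj G w w′
    siblings-adjacent t<r ly w∈ w′∈ w≢w′ =
      let (yw , lw) = ∈-at-level⁻ w∈ ; (yw′ , lw′) = ∈-at-level⁻ w′∈
          (q , lq , qw) = parent lw ; (q′ , lq′ , q′w′) = parent lw′
      in proj₂ (proj₂ (same-level-neighbours t<r ly lw lw′ yw yw′ w≢w′ lq lq′ qw q′w′))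

    -- A second neighbour on the level is needed because `same-level-neighbours` closes a cycle
    -- through two of them.
    siblings-share-parent : ∀ {t y c w} → suc (suc t) ≤ r → Lev (suc t) y → Lev t c → Adj G c y →
      2 ≤ length (at-level (suc t) y) → w ∈ˡ at-level (suc t) y → Adj G c w
    siblings-share-parent {t} {y} t<r ly lc cy 2≤ w∈ =
      let (w′ , w′∈ , w′≢w) = another (unique-at-level (suc t) y) 2≤ w∈
          (yw , lw) = ∈-at-level⁻ w∈ ; (yw′ , lw′) = ∈-at-level⁻ w′∈
          (q , lq , qw) = parent lw ; (q′ , lq′ , q′w′) = parent lw′
          (_ , qy , _) = same-level-neighbours t<r ly lw lw′ yw yw′ (w′≢w ∘ sym) lq lq′ qw q′w′
      in subst (λ p → Adj G p _) (unique-parent (<⇒≤ t<r) ly lq lc qy cy) qw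

    clique-∷ : ∀ {a xs} → (∀ {x} → x ∈ˡ xs → Adj G a x) →
               (∀ {x y} → x ∈ˡ xs → y ∈ˡ xs → x ≢ y → Adj G x y) →
               ∀ {x y} → x ∈ˡ a ∷ xs → y ∈ˡ a ∷ xs → x ≢ y → Adj G x y
    clique-∷ adj clique (here refl) (here refl) ne = ⊥-elim (ne refl)
    clique-∷ adj clique (here refl) (there y∈)  ne = adj y∈
    clique-∷ adj clique (there x∈)  (here refl) ne = symAdj G (adj x∈)
    clique-∷ adj clique (there x∈)  (there y∈)  ne = clique x∈ y∈ ne

    unique-∷ : ∀ {a xs} → (∀ {x} → x ∈ˡ xs → Adj G a x) → Unique xs → Unique (a ∷ xs)
    unique-∷ adj u = ¬Any⇒All¬ _ (λ a∈ → irrefl G refl (adj a∈)) ∷ u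

    -- The neighbours of `y` are `c`, those in `B` and at most one marked node. Hence `c`, `y` and
    -- `B` form a clique of at least Δ nodes.
    module Childless {t y c} (t<r : suc (suc t) ≤ r) (ly : Lev (suc t) y) (lc : Lev t c) (cy : Adj G c y)
                     (childless : length (at-level (suc (suc t)) y) ≤ 0) where

      B : List (Fin n)
      B = at-level (suc t) y

      Δ≤marked+B : Δ ≤ suc (length (marked y) + length B)
      Δ≤marked+B = ≤-trans (degree-inner (<⇒≤ t<r) ly)
        (s≤s (+-monoʳ-≤ (length (marked y)) (≤-trans (+-monoʳ-≤ (length B) childless) (≤-reflexive (+-identityʳ _)))))

      Δ≤2+B : Δ ≤ 2 + length B
      Δ≤2+B = ≤-trans Δ≤marked+B (s≤s (+-monoˡ-≤ _ (marked≤1 (<⇒≤ t<r) ly)))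

      Δ∸2≤B : Δ ∸ 2 ≤ length B
      Δ∸2≤B = ∸-monoˡ-≤ 2 Δ≤2+B

      2≤B : 2 ≤ length B
      2≤B = ≤-trans (∸-monoˡ-≤ 2 4≤Δ) Δ∸2≤B

      B⊆children : ∀ {w} → w ∈ˡ B → Adj G c w
      B⊆children = siblings-share-parent t<r ly lc cy 2≤B

      y-adj : ∀ {w} → w ∈ˡ B → Adj G y w
      y-adj = proj₁ ∘ ∈-at-level⁻

      block-clique : ∀ {w w′} → w ∈ˡ y ∷ B → w′ ∈ˡ y ∷ B → w ≢ w′ → Adj G w w′
      block-clique = clique-∷ y-adj (siblings-adjacent t<r ly)

      c-adj : ∀ {w} → w ∈ˡ y ∷ B → Adj G c w
      c-adj (here refl) = cy
      c-adj (there w∈)  = B⊆children w∈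

      block-unique : Unique (c ∷ y ∷ B)
      block-unique = unique-∷ c-adj (unique-∷ y-adj (unique-at-level (suc t) y))

      -- Otherwise the clique `c ∷ y ∷ B` would have Δ+1 nodes.
      has-marked-neighbour : ∃[ a ] Adj G y a × ¬ U a
      has-marked-neighbour with marked y in eq
      ... | a ∷ _ = a , ∈-marked⁻ (subst (a ∈ˡ_) (sym eq) (here refl))
      ... | []    = ⊥-elim (too-large-clique block-unique (clique-∷ c-adj block-clique)
                      (s≤s (subst (λ ms → Δ ≤ suc (length ms + length B)) eq Δ≤marked+B)))

      -- A marked node adjacent to the whole block would complete K_{Δ+1}.
      no-apex : ∀ {a} → Adj G a c → (∀ {w} → w ∈ˡ y ∷ B → Adj G a w) → ⊥
      no-apex {a} ac aw = too-large-clique (unique-∷ adj block-unique) (clique-∷ adj (clique-∷ c-adj block-clique))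
                            (s≤s Δ≤2+B)
        where
        adj : ∀ {w} → w ∈ˡ c ∷ y ∷ B → Adj G a w
        adj (here refl) = ac
        adj (there w∈)  = aw w∈

    no-two-childless : ∀ {t y z c} → suc (suc t) ≤ r → Lev (suc t) y → Lev (suc t) z → Lev t c →
      Adj G c y → Adj G c z → Adj G y z →
      length (at-level (suc (suc t)) y) ≤ 0 → length (at-level (suc (suc t)) z) ≤ 0 → ⊥
    no-two-childless {t} {y} {z} {c} t<r ly lz lc cy cz yz yless zless
      with Childless.has-marked-neighbour t<r ly lc cy yless | Childless.has-marked-neighbour t<r lz lc cz zless
    ... | a , ya , ¬Ua | a′ , za′ , ¬Ua′ with a ≟ a′
    ... | yes refl = no-apex ac a-adj
      where
      open Childless t<r ly lc cy yless
      y≢z : y ≢ z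
      y≢z eq = irrefl G eq yz
      a≢ : ∀ {s w} → Lev s w → a ≢ w
      a≢ lw refl = ¬Ua (Lev⇒U lw)
      2≤r : 2 ≤ r
      2≤r = ≤-trans (s≤s (s≤s z≤n)) t<r
      ac : Adj G a c
      ac = decidable-stable (adj? G a c)
        (no-C₄ 2≤r (symAdj G ya) (symAdj G cy) cz za′ (a≢ lc) y≢z)
      a-adj : ∀ {w} → w ∈ˡ y ∷ B → Adj G a w
      a-adj (here refl) = symAdj G ya
      a-adj {w} (there w∈) with w ≟ z
      ... | yes refl = symAdj G za′
      ... | no w≢z   = decidable-stable (adj? G a w)
        (no-C₄ 2≤r (symAdj G ya) (y-adj w∈)
          (block-clique (there w∈) (there (∈-at-level⁺ yz lz)) w≢z) za′
          (a≢ (proj₂ (∈-at-level⁻ w∈))) y≢z)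
    ... | no a≢a′ with common-selector ¬Ua ¬Ua′ a≢a′ ya yz za′
    ... | s , sa , sa′ , ¬aa′ =
      contradiction-DCC noDCC a∈ a′∈ a≢a′ ¬aa′ (here refl) reach
      where
      -- The hexagon y c z a′ s a has radius 2 (centre y), because of the chord y z.
      s≢ : ∀ {i w} → i ≤ r → Lev i w → w ≢ s
      -- The selector `s` has two marked neighbours, so it is no tree node.
      s≢ i≤r lw refl = a≢a′ (noT i≤r lw sa sa′ ¬Ua ¬Ua′)
      ≢marked : ∀ {i w m} → Lev i w → ¬ U m → w ≢ m
      ≢marked lw ¬Um refl = ¬Um (Lev⇒U lw)
      ne : ∀ {i j} → Adj G i j → i ≢ j
      ne ij eq = irrefl G eq ij
      t≤r : t ≤ r
      t≤r = ≤-trans (n≤1+n t) (<⇒≤ t<r)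
      as = symAdj G sa
      ay = symAdj G ya
      open EvenCycle G (step (symAdj G cy) (step cz (step za′ (step (symAdj G sa′) (step sa stop)))))
        ( (ne cy ∘ sym ∷ ne yz ∷ ≢marked ly ¬Ua′ ∷ s≢ (<⇒≤ t<r) ly ∷ ≢marked ly ¬Ua ∷ [])
        ∷ (ne cz ∷ ≢marked lc ¬Ua′ ∷ s≢ t≤r lc ∷ ≢marked lc ¬Ua ∷ [])
        ∷ (≢marked lz ¬Ua′ ∷ s≢ (<⇒≤ t<r) lz ∷ ≢marked lz ¬Ua ∷ [])
        ∷ (ne sa′ ∘ sym ∷ a≢a′ ∘ sym ∷ []) ∷ (ne sa ∷ []) ∷ [] ∷ [])
        ay (divides 3 refl) (s≤s z≤n)
        using (L; contradiction-DCC)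
      z∈ : z ∈ˡ L
      z∈ = there (there (here refl))
      a′∈ : a′ ∈ˡ L
      a′∈ = there (there (there (here refl)))
      a∈ : a ∈ˡ L
      a∈ = there (there (there (there (there (here refl)))))
      1≤r : 1 ≤ r
      1≤r = ≤-trans (s≤s z≤n) t<r
      2≤r : 2 ≤ r
      2≤r = ≤-trans (s≤s (s≤s z≤n)) t<r
      reach : ∀ {x} → x ∈ˡ L → ∃[ d ] d ≤ r × Σ (Walk G d y x) λ q → vertices G q ⊆ L
      reach (here refl) = 0 , z≤n , stop , λ { (here refl) → here refl }
      reach m@(there (here refl)) =
        1 , 1≤r , step (symAdj G cy) stop , λ { (here refl) → here refl ; (there (here refl)) → m }
      reach m@(there (there (here refl))) =
        1 , 1≤r , step yz stop , λ { (here refl) → here refl ; (there (here refl)) → m }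
      reach m@(there (there (there (here refl)))) =
        2 , 2≤r , step yz (step za′ stop)
        , λ { (here refl) → here refl ; (there (here refl)) → z∈ ; (there (there (here refl))) → m }
      reach m@(there (there (there (there (here refl))))) =
        2 , 2≤r , step ya (step as stop)
        , λ { (here refl) → here refl ; (there (here refl)) → a∈ ; (there (there (here refl))) → m }
      reach m@(there (there (there (there (there (here refl)))))) =
        1 , 1≤r , step ya stop , λ { (here refl) → here refl ; (there (here refl)) → m }

    -- Growth by the factor Δ-2 every two levels.

    Child : ℕ → Fin n → Fin n → Set
    Child t c y = (Adj G c y × Lev (suc t) y) × Good (suc t) y

    -- If some child `y` is childless, its neighbours on the same level are at least Δ-2 children of
    -- `c`, and none of them is childless too.
    good-children : ∀ {t c m} → suc t ≤ r → Lev t c → m ≤ length (at-level (suc t) c) → m ≤ Δ ∸ 2 →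
                    Many m (Child t c)
    good-children {t} {c} t<r lc m≤ m≤Δ∸2 with suc (suc t) ≤? r
    ... | no t≮r = at-level (suc t) c , unique-at-level (suc t) c
                 , (λ y∈ → ∈-at-level⁻ y∈ , λ t<r → ⊥-elim (t≮r t<r)) , m≤
    ... | yes t<<r with Any.any? (λ y → length (at-level (suc (suc t)) y) ≤? 0) (at-level (suc t) c)
    ... | no ¬some = at-level (suc t) c , unique-at-level (suc t) c
                  , (λ y∈ → ∈-at-level⁻ y∈ , λ _ → ≰⇒> (λ yless → ¬some (lose y∈ yless))) , m≤
    ... | yes some with find some
    ... | y , y∈ , yless = B , unique-at-level (suc t) y
        , (λ w∈ → let (yw , lw) = ∈-at-level⁻ w∈
                      cw = B⊆children w∈
                  in (cw , lw) , λ _ → ≰⇒> (no-two-childless t<<r ly lw lc cy cw yw yless))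
        , ≤-trans m≤Δ∸2 Δ∸2≤B
      where
      cy = proj₁ (∈-at-level⁻ y∈)
      ly = proj₂ (∈-at-level⁻ y∈)
      open Childless t<<r ly lc cy yless

    Grandchild : ℕ → Fin n → Fin n → Set
    Grandchild t x y = ∃[ c ] Lev (suc t) c × Adj G x c × Adj G c y

    grandchildren-of : ∀ {t x k m} → suc (suc t) ≤ r → m ≤ Δ ∸ 2 →
      Many k (λ c → (Adj G x c × Lev (suc t) c) × m ≤ length (at-level (suc (suc t)) c)) →
      Many (k * m) (λ y → Grandchild t x y × Lev (suc (suc t)) y × Good (suc (suc t)) y)
    grandchildren-of {t} t<r m≤ cs =
      Many-* (λ c y → Adj G c y × Lev (suc (suc t)) y)
        (λ ((_ , lc) , _) ((_ , lc′) , _) (cy , ly) (c′y , _) → unique-parent t<r ly lc lc′ cy c′y)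
        cs
        λ {c} ((xc , lc) , m≤K) →
          let (ys , u , p , len) = good-children t<r lc m≤K m≤
          in ys , u , (λ y∈ → let ((cy , ly) , good) = p y∈ in (cy , ly) , (c , lc , xc , cy) , ly , good) , len

    good-grandchildren : ∀ {t x} → suc (suc t) ≤ r → Lev t x → Good t x →
      Many (Δ ∸ 2) (λ y → Grandchild t x y × Lev (suc (suc t)) y × Good (suc (suc t)) y)
    good-grandchildren {t} {x} t<r lx good with Δ ∸ 2 ≤? length (at-level (suc t) x)
    -- Δ-2 good children contribute one good grandchild each.
    ... | yes many =
      let (cs , u , p , len) = good-children (<⇒≤ t<r) lx many ≤-refl
      in Many-mono (≤-reflexive (sym (*-identityʳ (Δ ∸ 2))))
           (grandchildren-of t<r 1≤Δ∸2 (cs , u , (λ c∈ → let (q , g) = p c∈ in q , g t<r) , len))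
    good-grandchildren {zero} {x} t<r lx good | no few =
      ⊥-elim (few (∸-monoˡ-≤ 2 (≤-trans (degree-root lx)
        (+-mono-≤ (≤-trans (marked≤1 z≤n lx) (n≤1+n 1)) ≤-refl))))
    good-grandchildren {suc t} {x} t<r lx good | no few
      with at-level (suc t) x in eqS | at-level (suc (suc t)) x in eqK
    -- Without a neighbour on its own level, `x` would have Δ-2 children.
    ... | [] | K = ⊥-elim (few (subst₂ (λ S K → Δ ∸ 2 ≤ length S + length K) eqS eqK
                     (Δ∸2≤ (≤-trans (n≤1+n _) (<⇒≤ t<r)) lx)))
    ... | _ ∷ _ | [] = ⊥-elim (1+n≰n (good (<⇒≤ t<r)))
    ... | y ∷ _ | c ∷ K = 
            -- The clique `c ∷ B` has `suc b` nodes, each with at least Δ-2-b children.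
            Many-mono (n≤1+k*[n∸k] b (Δ ∸ 2) b<)
              (grandchildren-of t<r (m∸n≤m (Δ ∸ 2) b)
                (c ∷ B , unique-∷ (proj₁ ∘ ∈-at-level⁻) (unique-at-level _ c) , member , ≤-refl))
      where
      c∈ : c ∈ˡ at-level (suc (suc t)) x
      c∈ = subst (c ∈ˡ_) (sym eqK) (here refl)
      xc = proj₁ (∈-at-level⁻ c∈)
      lc = proj₂ (∈-at-level⁻ c∈)
      y∈ : y ∈ˡ at-level (suc t) x
      y∈ = subst (y ∈ˡ_) (sym eqS) (here refl)
      B = at-level (suc (suc t)) c
      b = length B
      child : ∀ {w} → w ∈ˡ c ∷ B → Adj G x w × Lev (suc (suc t)) w
      child (here refl) = xc , lc
      child (there w∈) with ∈-at-level⁻ w∈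
      ... | cw , lw with parent lw
      ... | x′ , lx′ , x′w with x ≟ x′
      ... | yes refl = x′w , lw
      -- The neighbour `y` of `x` on its level prevents `c` from touching a child of another node.
      ... | no x≢x′ = ⊥-elim (no-cousins t<r lx lx′ (proj₂ (∈-at-level⁻ y∈)) lc lw xc x′w cw
                                (proj₁ (∈-at-level⁻ y∈)) x≢x′)
      b< : b < Δ ∸ 2
      b< = ≤-trans (unique-⊆-length (unique-∷ (proj₁ ∘ ∈-at-level⁻) (unique-at-level _ c))
             (λ w∈ → let (xw , lw) = child w∈ in subst (_ ∈ˡ_) eqK (∈-at-level⁺ xw lw))) (<⇒≤ (≰⇒> few))
      B-closed : ∀ {w} → w ∈ˡ c ∷ B → length (at-level (suc (suc t)) w) ≤ b
      B-closed {w} w∈ = s≤s⁻¹ (unique-⊆-length {ys = c ∷ B}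
        (unique-∷ (proj₁ ∘ ∈-at-level⁻) (unique-at-level _ w)) (sub w∈))
        where
        sub : w ∈ˡ c ∷ B → w ∷ at-level (suc (suc t)) w ⊆ c ∷ B
        sub w∈ (here refl) = w∈
        sub (here refl) (there w′∈) = there w′∈
        sub (there w∈) {w′} (there w′∈) with c ≟ w′
        ... | yes refl = here refl
        ... | no c≢w′ =
          let (cw , lw) = ∈-at-level⁻ w∈ ; (_ , lw′) = ∈-at-level⁻ w′∈
          in there (∈-at-level⁺ (siblings-adjacent t<r lw (∈-at-level⁺ (symAdj G cw) lc) w′∈ c≢w′) lw′)
      member : ∀ {w} → w ∈ˡ c ∷ B →
               (Adj G x w × Lev (suc (suc t)) w) × Δ ∸ 2 ∸ b ≤ length (at-level (suc (suc (suc t))) w)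
      member w∈ = child w∈ , m≤n+o⇒m∸n≤o (Δ ∸ 2) b
        (≤-trans (Δ∸2≤ (<⇒≤ t<r) (proj₂ (child w∈))) (+-monoˡ-≤ _ (B-closed w∈)))

    -- Being good is carried along, since only good nodes are known to have enough good
    -- grandchildren.
    descendants : ∀ j → j * 2 ≤ r → Many ((Δ ∸ 2) ^ j) (λ u → Lev (j * 2) u × Good (j * 2) u)
    descendants zero _ =
      v ∷ [] , [] ∷ [] , (λ { (here refl) → lev-v , λ 0<r →
        s≤s⁻¹ (≤-trans (≤-trans (s≤s (s≤s z≤n)) 4≤Δ)
          (≤-trans (degree-root lev-v) (+-monoˡ-≤ _ (marked≤1 z≤n lev-v)))) }) , ≤-refl
    descendants (suc j) j<r = Many-mono (≤-reflexive (*-comm (Δ ∸ 2) ((Δ ∸ 2) ^ j)))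
      (Many-* (λ x y → Grandchild (j * 2) x y × Lev (suc (suc (j * 2))) y)
        -- Grandparents are unique by two uses of `unique-parent`, so different nodes have disjoint
        -- sets of grandchildren.
        (λ { (lx , _) (lx′ , _) ((c , lc , xc , cy) , ly) ((c′ , lc′ , x′c′ , c′y) , _) →
             unique-parent (<⇒≤ j<r) lc lx lx′ xc
               (subst (Adj G _) (unique-parent j<r ly lc′ lc c′y cy) x′c′) })
        (descendants j (≤-trans (n≤1+n _) (<⇒≤ j<r)))
        λ (lx , good) → let (ys , u , p , len) = good-grandchildren j<r lx good
                        in ys , u , (λ y∈ → let (g , ly , gy) = p y∈ in (g , ly) , ly , gy) , len)

-- Agreement of levels with distances in the unmarked graph.

unmarked : ∀ {n} {χ : Colouring n} (u : Unmarked χ) → χ (value u) ≡ nothing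
unmarked {χ = χ} (u , irr Uu) = recompute (≡-dec ℕ._≟_ (χ u) nothing) Uu

module _ {n} (G : Graph (Fin n)) (χ : Colouring n) (v : Unmarked χ) where

  private
    H = unmarkedGraph G χ

  open Levels G χ (value v) (unmarked {χ = χ} v)

  -- Bounds distances in `G`, in which the degree hypothesis is stated.
  Reach⇒Walk : ∀ {k u} → Reach k u → Walk G k (value v) u
  Reach⇒Walk {zero}  refl                = stop
  Reach⇒Walk {suc k} (_ , _ , p , wu) = snoc G (Reach⇒Walk p) wu

  Reach⇒Walkᴴ : ∀ {k u} .{Uu : U u} → Reach k u → Walk H k v (u , irr Uu)
  Reach⇒Walkᴴ {zero}  refl                = stop
  Reach⇒Walkᴴ {suc k} (_ , w , p , wu) = snoc H (Reach⇒Walkᴴ {u = w} {Uu = Reach⇒U p} p) wu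

  Walkᴴ⇒Reach : ∀ {i k x y} → Reach i (value x) → Walk H k x y → Reach (k + i) (value y)
  Walkᴴ⇒Reach p stop = p
  Walkᴴ⇒Reach {i} {suc k} {x} {z} p (step {y = y} e w) =
    subst (λ j → Reach j (value z)) (+-suc k i) (Walkᴴ⇒Reach {i = suc i} {x = y} (unmarked {χ = χ} y , value x , p , e) w)

  Lev⇒BFSLevel : ∀ {k u} .{Uu : U u} → Lev k u → BFSLevel H v k (u , irr Uu)
  Lev⇒BFSLevel (p , least) = Reach⇒Walkᴴ p , λ j w →
    least j (subst (λ i → Reach i _) (+-identityʳ j) (Walkᴴ⇒Reach {x = v} refl w))

  BFSLevel⇒Path : ∀ {k u} → BFSLevel H v k u → Path H k v u
  BFSLevel⇒Path (w , least) = w , shortest-unique H w least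

-- Dichotomy between a T-node and full growth.

lemma14 : ∀ {n} (G : Graph (Fin n)) (r Δ : ℕ) →
    2 ∣ r →
    Nice G →
    MaxDegree G Δ →
    4 ≤ Δ →
    NoDCCOfRadiusAtMost G r →
    (χ : Colouring n) →
    MarkingOutcome G 6 χ →
    (v : Unmarked χ) →
    (∀ u → Within G r (value v) u → degree G u ≡ Δ) →
    let H = unmarkedGraph G χ in
    AtLeast ((Δ ∸ 2) ^ (r / 2)) (λ u → BFSLevel H v r u × Path H r v u)
    ⊎ (∃[ u ] InBFSTree H v r u × TNode G χ (value u) × (∃[ k ] Path H k v u))
lemma14 G r Δ (divides q r≡q*2) nice maxΔ 4≤Δ noDCC χ marking v full = go tNode?
  where
  open Levels G χ (value v) (unmarked {χ = χ} v)
  open MarkingOutcome marking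

  H = unmarkedGraph G χ

  -- Marked nodes all have colour 1, so this amounts to being a T-node, in decidable form.
  MarkedPair : Fin _ → Set
  MarkedPair u = ∃₂ λ x y → x ≢ y × Adj G u x × Adj G u y × ¬ U x × ¬ U y

  tNode? : Dec (∃[ u ] MarkedPair u × ∃ λ t → t < suc r × Lev t u)
  tNode? = any? λ u →
    any? (λ x → any? λ y → ¬? (x ≟ y) ×-dec adj? G u x ×-dec adj? G u y ×-dec ¬? (U? x) ×-dec ¬? (U? y))
    ×-dec anyUpTo? (λ t → lev? t u) (suc r)

  colour : ∀ {x} → ¬ U x → χ x ≡ just 1
  colour {x} ¬Ux with colours x
  ... | inj₁ (_ , eq) = eq
  ... | inj₂ (_ , Ux) = ⊥-elim (¬Ux Ux)

  full-degree : ∀ {t u} → t ≤ r → Lev t u → degree G u ≡ Δ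
  -- The distance in `G` is at most the level, but is known only under double negation; equality of
  -- numbers is decidable.
  full-degree {t} {u} t≤r (p , _) = decidable-stable (degree G u ℕ.≟ Δ) λ ≢Δ →
    ¬¬-least t (Reach⇒Walk G χ v p) λ (d , dist , d≤t) → ≢Δ (full u (d , dist , ≤-trans d≤t t≤r))

  go : Dec (∃[ u ] MarkedPair u × ∃ λ t → t < suc r × Lev t u) → _
  go (yes (u , (x , y , x≢y , ux , uy , ¬Ux , ¬Uy) , t , t<r , lu)) =
    inj₂ ((u , irr (Lev⇒U lu)) , (t , s≤s⁻¹ t<r , bfs)
         , (x , y , 1 , x≢y , ux , uy , colour ¬Ux , colour ¬Uy) , t , BFSLevel⇒Path G χ v bfs)
    where bfs = Lev⇒BFSLevel G χ v lu
  go (no ¬tNode) = inj₁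
    (mk↣ {to = λ i → Injection.to f i , irr (Lev⇒U (p i))} (λ eq → Injection.injective f (cong value eq))
    , λ i → let bfs = Lev⇒BFSLevel G χ v (p i) in bfs , BFSLevel⇒Path G χ v bfs)
    where
    open Tree.Growth G r Δ nice maxΔ 4≤Δ noDCC χ marking (value v) (unmarked {χ = χ} v) full-degree
      -- The failed search shows that no tree node has two different marked neighbours.
      (λ {t} {u} {x} {y} t≤r lu ux uy ¬Ux ¬Uy → decidable-stable (x ≟ y) λ x≢y →
         ¬tNode (u , (x , y , x≢y , ux , uy , ¬Ux , ¬Uy) , t , s≤s t≤r , lu))
    r/2≡q : r / 2 ≡ q
    r/2≡q = trans (cong (_/ 2) r≡q*2) (m*n/n≡m q 2)
    family : AtLeast ((Δ ∸ 2) ^ (r / 2)) (Lev r)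
    family = Many⇒AtLeast (subst₂ (λ k t → Many ((Δ ∸ 2) ^ k) (Lev t)) (sym r/2≡q) (sym r≡q*2)
      (let (xs , u , lev , len) = descendants q (≤-reflexive (sym r≡q*2)) in xs , u , (proj₁ ∘ lev) , len))
    f = proj₁ family
    p = proj₂ family
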